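{- Let $G$ be a strongly regular graph with parameters $(76,21,2,7)$ and let $v\mapsto x_v$ be a map from $V(G)$ to unit vectors in $\mathbb{R}^{19}$ with $(x_a,x_b)=-\frac13$ for adjacent $a,b$ and $(x_a,x_b)=\frac19$ for distinct non-adjacent $a,b$. Fix a vertex $u$; for $v\in G_1(u)$ put $\hat v=\frac32 x_v+\frac12 x_u$, and for $w\in G_2(u)$ put $\hat w=\frac94 x_w-\frac14 x_u$. Let $C$ be a connected component (a cycle) of the subgraph induced on $G_1(u)$, of length $t$, let $w\in G_2(u)$, let $N$ be the set of neighbours of $w$ on $C$ and $s=|N|$ (so that $t=3s$), let $U$ be the span of $\{\hat v: v\in C\}$ and let $p$ be the orthogonal projection of $\hat w$ onto $U$. Then $(p,p)\ge \frac s2$. Moreover, $(p,p)=\frac s2$ if and only if the vertices of $N$ are evenly spaced on $C$, containing every third vertex along $C$, and $p=-\frac12\sum_{v\in N}\hat v$.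
   Context: A graph is strongly regular with parameters $(v,k,\lambda,\mu)$ if it has $v$ vertices, every vertex has $k$ neighbours, any two adjacent vertices have exactly $\lambda$ common neighbours, and any two distinct non-adjacent vertices have exactly $\mu$ common neighbours. $G_1(u)$ denotes the set of neighbours of $u$ and $G_2(u)$ the set of vertices at distance $2$ from $u$. Since $\lambda=2$, the subgraph induced on $G_1(u)$ is a disjoint union of cycles. $(\cdot,\cdot)$ is the standard inner product on $\mathbb{R}^{19}$. (Such a unit vector representation exists for any such $G$, coming from the eigenspace of the eigenvalue $-7$ of its adjacency matrix.) -}

module Defs where

open import Data.Nat using (ℕ; zero; suc)
open import Data.Fin using (Fin; zero; suc; toℕ)
open import Data.Bool using (Bool; true; false; if_then_else_)
open import Data.Product using (Σ; _×_; _,_; ∃)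
open import Data.Empty using (⊥)
open import Data.Sum using (_⊎_)
open import Data.Nat.DivMod using (_mod_; _%_)
open import Relation.Nullary using (¬_)
open import Relation.Binary.PropositionalEquality using (_≡_)

-- The real numbers, axiomatised as a complete ordered field.
-- (agda-stdlib has no real numbers; every model of this record is, classically,
-- isomorphic to ℝ, so quantifying over all models is the same as stating the
-- result for ℝ.)

record RealField : Set₁ where
  infixl 6 _+_
  infixl 7 _*_
  infix  4 _≤_
  infix  9 _⁻¹
  infix  8 -_
  field
    ℝ     : Set
    0ℝ 1ℝ : ℝ
    _+_ _*_ : ℝ → ℝ → ℝ
    -_    : ℝ → ℝ
    _⁻¹   : ℝ → ℝ
    _≤_   : ℝ → ℝ → Set
    +-assoc   : ∀ a b c → (a + b) + c ≡ a + (b + c)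
    +-comm    : ∀ a b → a + b ≡ b + a
    +-identityˡ : ∀ a → 0ℝ + a ≡ a
    +-inverseˡ  : ∀ a → (- a) + a ≡ 0ℝ
    *-assoc   : ∀ a b c → (a * b) * c ≡ a * (b * c)
    *-comm    : ∀ a b → a * b ≡ b * a
    *-identityˡ : ∀ a → 1ℝ * a ≡ a
    *-inverseˡ  : ∀ a → ¬ (a ≡ 0ℝ) → (a ⁻¹) * a ≡ 1ℝ
    distribˡ  : ∀ a b c → a * (b + c) ≡ (a * b) + (a * c)
    0≢1       : ¬ (0ℝ ≡ 1ℝ)
    ≤-refl    : ∀ a → a ≤ a
    ≤-antisym : ∀ {a b} → a ≤ b → b ≤ a → a ≡ b
    ≤-trans   : ∀ {a b c} → a ≤ b → b ≤ c → a ≤ c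
    ≤-total   : ∀ a b → (a ≤ b) ⊎ (b ≤ a)
    +-mono-≤  : ∀ {a b} c → a ≤ b → a + c ≤ b + c
    *-nonneg  : ∀ {a b} → 0ℝ ≤ a → 0ℝ ≤ b → 0ℝ ≤ a * b
    sup : (S : ℝ → Set) → Σ ℝ S → Σ ℝ (λ b → ∀ x → S x → x ≤ b) →
          Σ ℝ (λ l → (∀ x → S x → x ≤ l) ×
                     (∀ b → (∀ x → S x → x ≤ b) → l ≤ b))

count : ∀ {n} → (Fin n → Bool) → ℕ
count {zero}  f = zero
count {suc n} f = (if f zero then suc zero else zero) Data.Nat.+ count (λ i → f (suc i))

IsSimpleGraph : ∀ {n} → (Fin n → Fin n → Bool) → Set
IsSimpleGraph {n} A = (∀ a → A a a ≡ false) × (∀ a b → A a b ≡ A b a)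

common : ∀ {n} → (Fin n → Fin n → Bool) → Fin n → Fin n → ℕ
common A a b = count (λ c → A a c Data.Bool.∧ A b c)

IsSRG : (v k l m : ℕ) → (Fin v → Fin v → Bool) → Set
IsSRG v k l m A =
  IsSimpleGraph A ×
  (∀ a → count (A a) ≡ k) ×
  (∀ a b → ¬ (a ≡ b) → A a b ≡ true  → common A a b ≡ l) ×
  (∀ a b → ¬ (a ≡ b) → A a b ≡ false → common A a b ≡ m)

InG₁ : ∀ {n} → (Fin n → Fin n → Bool) → Fin n → Fin n → Set
InG₁ A u v = A u v ≡ true

InG₂ : ∀ {n} → (Fin n → Fin n → Bool) → Fin n → Fin n → Set
InG₂ A u w = ¬ (w ≡ u) × A u w ≡ false × ∃ (λ c → A u c ≡ true × A c w ≡ true)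

csuc : ∀ {m} → Fin (suc m) → Fin (suc m)
csuc {m} i = suc (toℕ i) mod (suc m)

-- c : Fin (suc m) → Fin n enumerates (in cyclic order) a connected component
-- of the subgraph induced on G₁(u), that component being a cycle of length
-- t = suc m ≥ 3.
IsCycleComponentOfG₁ : ∀ {n} → (Fin n → Fin n → Bool) → Fin n →
                       (m : ℕ) → (Fin (suc m) → Fin n) → Set
IsCycleComponentOfG₁ A u m c =
  (2 Data.Nat.≤ m) ×
  (∀ i j → c i ≡ c j → i ≡ j) ×
  (∀ i → InG₁ A u (c i)) ×
  (∀ i → A (c i) (c (csuc i)) ≡ true) ×
  (∀ i v → InG₁ A u v → A (c i) v ≡ true → ∃ (λ j → c j ≡ v))

module Linear (R : RealField) where
  open RealField R

  fromℕ : ℕ → ℝ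
  fromℕ zero    = 0ℝ
  fromℕ (suc n) = 1ℝ + fromℕ n

  ∑ : ∀ {n} → (Fin n → ℝ) → ℝ
  ∑ {zero}  f = 0ℝ
  ∑ {suc n} f = f zero + ∑ (λ i → f (suc i))

  Vec : ℕ → Set
  Vec d = Fin d → ℝ

  ⟪_,_⟫ : ∀ {d} → Vec d → Vec d → ℝ
  ⟪ x , y ⟫ = ∑ (λ k → x k * y k)

  _+ᵛ_ : ∀ {d} → Vec d → Vec d → Vec d
  (x +ᵛ y) k = x k + y k

  _-ᵛ_ : ∀ {d} → Vec d → Vec d → Vec d
  (x -ᵛ y) k = x k + (- (y k))

  infixr 7 _·_
  infixl 6 _+ᵛ_ _-ᵛ_
  _·_ : ∀ {d} → ℝ → Vec d → Vec d
  (a · x) k = a * x k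

  ∑ᵛ : ∀ {d n} → (Fin n → Vec d) → Vec d
  ∑ᵛ f k = ∑ (λ i → f i k)

  IsOrthProj : ∀ {d n} → (Fin n → Vec d) → Vec d → Vec d → Set
  IsOrthProj {d} {n} g y p =
    Σ (Fin n → ℝ) (λ α → ∀ k → p k ≡ ∑ (λ i → α i * g i k)) ×
    (∀ i → ⟪ y -ᵛ p , g i ⟫ ≡ 0ℝ)

  hat₁ : ∀ {n d} → (Fin n → Vec d) → Fin n → Fin n → Vec d
  hat₁ x u v = ((fromℕ 3 * fromℕ 2 ⁻¹) · x v) +ᵛ (fromℕ 2 ⁻¹ · x u)

  hat₂ : ∀ {n d} → (Fin n → Vec d) → Fin n → Fin n → Vec d
  hat₂ x u w = ((fromℕ 9 * fromℕ 4 ⁻¹) · x w) -ᵛ (fromℕ 4 ⁻¹ · x u)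

module Submission where

-- Write g_i = v̂ for the vertices c_i of the cycle C, N = {i : w ~ c_i}, s = |N|,
-- and q = -1/2 ∑_{i∈N} g_i.  From the inner products of the x_v one computes
--   ⟪g_i,g_i⟫ = 2,  ⟪g_i,g_j⟫ = -1 (adjacent) or 0 (non-adjacent),
--   ⟪ŵ,g_j⟫ = -1 (j ∈ N) or 1/2 (j ∉ N),
-- and ⟪p,g_j⟫ = ⟪ŵ,g_j⟫ since p is the projection.  Hence ⟪p,q⟫ = s/2, while
-- ⟪q,q⟫ ≤ s/2 because the off-diagonal Gram entries are non-positive.  Then
-- 0 ≤ ⟪p-q,p-q⟫ = (⟪p,p⟫ - s/2) + (⟪q,q⟫ - s/2) gives ⟪p,p⟫ ≥ s/2, with equality
-- only if p = q.  If p = q, comparing ⟪q,g_j⟫ = ⟪p,g_j⟫ for a vertex c_j whose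
-- only cycle neighbours are c_{j-1}, c_{j+1} (this is where λ = 2 enters) shows
-- that exactly one of j-1, j, j+1 lies in N, so N is a residue class mod 3.

open import Defs
open import Data.Nat using (ℕ; suc; _<_; _%_)
open import Data.Fin using (Fin; toℕ)
open import Data.Bool using (Bool; true; false; if_then_else_)
open import Data.Bool using (_∧_)
open import Data.Product using (Σ; _×_; ∃)
open import Relation.Nullary using (¬_)
open import Relation.Binary.PropositionalEquality using (_≡_)
open import Function.Bundles using (_⇔_)

open import Data.Nat as ℕ using (zero)
import Data.Nat.Properties as ℕₚ
open import Data.Integer as ℤ using (ℤ; -[1+_])
import Data.Integer.Properties as ℤₚ
open import Data.Sign using () renaming (- to minus)
open import Data.Maybe using (Maybe; just; nothing)
open import Data.Product using (_,_; proj₁; proj₂)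
open import Data.Sum using (_⊎_; inj₁; inj₂)
open import Data.Empty using (⊥-elim)
open import Function using (_⟨_⟩_)
open import Function.Bundles using (mk⇔; Equivalence)
open import Relation.Nullary using (Dec; yes; no; does)
open import Relation.Nullary.Decidable using (dec-true; dec-false)
import Data.Fin.Properties as Finₚ
open import Data.Fin using (zero; suc; _≟_; punchIn)
open import Relation.Binary.PropositionalEquality
  using (refl; sym; trans; cong; cong₂; subst; subst₂; isEquivalence; module ≡-Reasoning)
open import Algebra.Bundles using (CommutativeRing)
open import Algebra.Structures using (IsCommutativeRing)
import Algebra.Properties.Ring as RingProperties
import Algebra.Properties.Semiring.Sum as SemiringSum
open import Algebra.Solver.Ring.AlmostCommutativeRing
  using (fromCommutativeRing; _-Raw-AlmostCommutative⟶_)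

module RealFieldArithmetic (R : RealField) where
  open RealField R
  open Linear R using (fromℕ)
  open ≡-Reasoning

  infixl 6 _-_
  _-_ : ℝ → ℝ → ℝ
  a - b = a + (- b)

  +-identityʳ : ∀ a → a + 0ℝ ≡ a
  +-identityʳ a = trans (+-comm a 0ℝ) (+-identityˡ a)

  +-inverseʳ : ∀ a → a + (- a) ≡ 0ℝ
  +-inverseʳ a = trans (+-comm a (- a)) (+-inverseˡ a)

  *-identityʳ : ∀ a → a * 1ℝ ≡ a
  *-identityʳ a = trans (*-comm a 1ℝ) (*-identityˡ a)

  distribʳ : ∀ a b c → (b + c) * a ≡ b * a + c * a
  distribʳ a b c = begin
    (b + c) * a   ≡⟨ *-comm (b + c) a ⟩
    a * (b + c)   ≡⟨ distribˡ a b c ⟩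
    a * b + a * c ≡⟨ cong₂ _+_ (*-comm a b) (*-comm a c) ⟩
    b * a + c * a ∎

  isCommutativeRing : IsCommutativeRing _≡_ _+_ _*_ -_ 0ℝ 1ℝ
  isCommutativeRing = record
    { isRing = record
      { +-isAbelianGroup = record
        { isGroup = record
          { isMonoid = record
            { isSemigroup = record
              { isMagma = record { isEquivalence = isEquivalence ; ∙-cong = cong₂ _+_ }
              ; assoc = +-assoc }
            ; identity = +-identityˡ , +-identityʳ }
          ; inverse = +-inverseˡ , +-inverseʳ
          ; ⁻¹-cong = cong (λ z → - z) }
        ; comm = +-comm }
      ; *-cong = cong₂ _*_
      ; *-assoc = *-assoc
      ; *-identity = *-identityˡ , *-identityʳ
      ; distrib = distribˡ , distribʳ }
    ; *-comm = *-comm }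

  commutativeRing : CommutativeRing _ _
  commutativeRing = record { isCommutativeRing = isCommutativeRing }

  open CommutativeRing commutativeRing public using (zeroˡ; zeroʳ)
  open RingProperties (CommutativeRing.ring commutativeRing) public
    using (-‿distribˡ-*; -‿distribʳ-*; -‿involutive; -0#≈0#; -‿+-comm)

  fromℕ-+ : ∀ m n → fromℕ (m ℕ.+ n) ≡ fromℕ m + fromℕ n
  fromℕ-+ zero    n = sym (+-identityˡ _)
  fromℕ-+ (suc m) n = trans (cong (1ℝ +_) (fromℕ-+ m n)) (sym (+-assoc 1ℝ _ _))

  fromℕ-* : ∀ m n → fromℕ (m ℕ.* n) ≡ fromℕ m * fromℕ n
  fromℕ-* zero    n = sym (zeroˡ _)
  fromℕ-* (suc m) n = begin
    fromℕ (n ℕ.+ m ℕ.* n)             ≡⟨ fromℕ-+ n (m ℕ.* n) ⟩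
    fromℕ n + fromℕ (m ℕ.* n)         ≡⟨ cong₂ _+_ (sym (*-identityˡ _)) (fromℕ-* m n) ⟩
    1ℝ * fromℕ n + fromℕ m * fromℕ n ≡⟨ sym (distribʳ _ 1ℝ (fromℕ m)) ⟩
    (1ℝ + fromℕ m) * fromℕ n         ∎

  ⟦_⟧ℤ : ℤ → ℝ
  ⟦ ℤ.+ n    ⟧ℤ = fromℕ n
  ⟦ -[1+ n ] ⟧ℤ = - fromℕ (suc n)

  ⊖-hom : ∀ m n → ⟦ m ℤ.⊖ n ⟧ℤ ≡ fromℕ m - fromℕ n
  ⊖-hom zero    zero    = sym (+-inverseʳ 0ℝ)
  ⊖-hom (suc m) zero    = sym (trans (cong (fromℕ (suc m) +_) -0#≈0#) (+-identityʳ _))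
  ⊖-hom zero    (suc n) = sym (+-identityˡ _)
  ⊖-hom (suc m) (suc n) = begin
    ⟦ suc m ℤ.⊖ suc n ⟧ℤ                 ≡⟨ cong ⟦_⟧ℤ (ℤₚ.[1+m]⊖[1+n]≡m⊖n m n) ⟩
    ⟦ m ℤ.⊖ n ⟧ℤ                         ≡⟨ ⊖-hom m n ⟩
    fromℕ m - fromℕ n                    ≡⟨ sym (cancel 1ℝ (fromℕ m) (fromℕ n)) ⟩
    (1ℝ + fromℕ m) - (1ℝ + fromℕ n)      ∎
    where
    cancel : ∀ a b c → (a + b) - (a + c) ≡ b - c
    cancel a b c = begin
      (a + b) + - (a + c)     ≡⟨ cong ((a + b) +_) (sym (-‿+-comm a c)) ⟩
      (a + b) + (- a + - c)   ≡⟨ cong (_+ (- a + - c)) (+-comm a b) ⟩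
      (b + a) + (- a + - c)   ≡⟨ +-assoc b a _ ⟩
      b + (a + (- a + - c))   ≡⟨ cong (b +_) (sym (+-assoc a (- a) (- c))) ⟩
      b + ((a + - a) + - c)   ≡⟨ cong (λ z → b + (z + - c)) (+-inverseʳ a) ⟩
      b + (0ℝ + - c)          ≡⟨ cong (b +_) (+-identityˡ (- c)) ⟩
      b - c                   ∎

  neg-hom : ∀ i → ⟦ ℤ.- i ⟧ℤ ≡ - ⟦ i ⟧ℤ
  neg-hom (ℤ.+ zero)  = sym -0#≈0#
  neg-hom (ℤ.+ suc n) = refl
  neg-hom -[1+ n ]    = sym (-‿involutive _)

  +-hom : ∀ i j → ⟦ i ℤ.+ j ⟧ℤ ≡ ⟦ i ⟧ℤ + ⟦ j ⟧ℤ
  +-hom (ℤ.+ m)  (ℤ.+ n)  = fromℕ-+ m n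
  +-hom (ℤ.+ m)  -[1+ n ] = ⊖-hom m (suc n)
  +-hom -[1+ m ] (ℤ.+ n)  = trans (⊖-hom n (suc m)) (+-comm _ _)
  +-hom -[1+ m ] -[1+ n ] = begin
    - fromℕ (suc (suc (m ℕ.+ n)))        ≡⟨ cong (λ k → - fromℕ (suc k)) (sym (ℕₚ.+-suc m n)) ⟩
    - fromℕ (suc m ℕ.+ suc n)            ≡⟨ cong (λ z → - z) (fromℕ-+ (suc m) (suc n)) ⟩
    - (fromℕ (suc m) + fromℕ (suc n))    ≡⟨ sym (-‿+-comm _ _) ⟩
    - fromℕ (suc m) + - fromℕ (suc n)    ∎

  *-hom : ∀ i j → ⟦ i ℤ.* j ⟧ℤ ≡ ⟦ i ⟧ℤ * ⟦ j ⟧ℤ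
  *-hom (ℤ.+ m)      (ℤ.+ n)      = trans (cong ⟦_⟧ℤ (ℤₚ.+◃n≡+n (m ℕ.* n))) (fromℕ-* m n)
  *-hom (ℤ.+ zero)   -[1+ n ]     = sym (zeroˡ _)
  *-hom (ℤ.+ suc m)  -[1+ n ]     =
    trans (cong (λ z → - z) (fromℕ-* (suc m) (suc n))) (-‿distribʳ-* _ _)
  *-hom -[1+ m ]     (ℤ.+ zero)   =
    trans (cong (λ k → ⟦ minus ℤ.◃ k ⟧ℤ) (ℕₚ.*-zeroʳ m)) (sym (zeroʳ _))
  *-hom -[1+ m ]     (ℤ.+ suc n)  =
    trans (cong (λ z → - z) (fromℕ-* (suc m) (suc n))) (-‿distribˡ-* _ _)
  *-hom -[1+ m ]     -[1+ n ]     = begin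
    fromℕ (suc m ℕ.* suc n)                   ≡⟨ fromℕ-* (suc m) (suc n) ⟩
    fromℕ (suc m) * fromℕ (suc n)             ≡⟨ sym (-‿involutive _) ⟩
    - (- (fromℕ (suc m) * fromℕ (suc n)))     ≡⟨ cong (λ z → - z) (-‿distribʳ-* _ _) ⟩
    - (fromℕ (suc m) * - fromℕ (suc n))       ≡⟨ -‿distribˡ-* _ _ ⟩
    - fromℕ (suc m) * - fromℕ (suc n)         ∎

  ℤ-morphism : ℤ.+-*-rawRing -Raw-AlmostCommutative⟶ fromCommutativeRing commutativeRing
  ℤ-morphism = record
    { ⟦_⟧ = ⟦_⟧ℤ ; +-homo = +-hom ; *-homo = *-hom ; -‿homo = neg-hom
    ; 0-homo = refl ; 1-homo = +-identityʳ 1ℝ }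

  coefficients≟ : ∀ i j → Maybe (⟦ i ⟧ℤ ≡ ⟦ j ⟧ℤ)
  coefficients≟ i j with i ℤ.≟ j
  ... | yes refl = just refl
  ... | no _     = nothing

  open import Algebra.Solver.Ring ℤ.+-*-rawRing (fromCommutativeRing commutativeRing)
    ℤ-morphism coefficients≟ public

  κ : ∀ {k} → ℕ → Polynomial k
  κ n = con (ℤ.+ n)

  -- The solver writes the unit as fromℕ 1.
  fromℕ-1 : fromℕ 1 ≡ 1ℝ
  fromℕ-1 = +-identityʳ 1ℝ

-- Order-theoretic facts in a model of the reals.  The one non-algebraic fact,
-- that a square vanishes only at 0, uses completeness (an Archimedean argument).
module RealFieldOrder (R : RealField) where
  open RealField R
  open Linear R using (fromℕ)
  open RealFieldArithmetic R
  open ≡-Reasoning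

  ≤-addˡ : ∀ {a b} c → a ≤ b → c + a ≤ c + b
  ≤-addˡ {a} {b} c a≤b = subst₂ _≤_ (+-comm a c) (+-comm b c) (+-mono-≤ c a≤b)

  ≤-add : ∀ {a b c d} → a ≤ b → c ≤ d → a + c ≤ b + d
  ≤-add {b = b} {c = c} a≤b c≤d = ≤-trans (+-mono-≤ c a≤b) (≤-addˡ b c≤d)

  sub-nonneg : ∀ {a b} → a ≤ b → 0ℝ ≤ b - a
  sub-nonneg {a} {b} a≤b = subst (_≤ b - a) (+-inverseʳ a) (+-mono-≤ (- a) a≤b)

  nonneg-sub : ∀ {a b} → 0ℝ ≤ b - a → a ≤ b
  nonneg-sub {a} {b} 0≤b-a =
    subst₂ _≤_ (+-identityˡ a) (solve 2 (λ a b → (b :- a) :+ a := b) refl a b) (+-mono-≤ a 0≤b-a)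

  neg-antitone : ∀ {a b} → a ≤ b → - b ≤ - a
  neg-antitone {a} {b} a≤b = subst₂ _≤_
    (solve 2 (λ a b → a :+ (:- a :+ :- b) := :- b) refl a b)
    (solve 2 (λ a b → b :+ (:- a :+ :- b) := :- a) refl a b)
    (+-mono-≤ (- a + - b) a≤b)

  nonpos⇒neg-nonneg : ∀ {a} → a ≤ 0ℝ → 0ℝ ≤ - a
  nonpos⇒neg-nonneg a≤0 = subst (_≤ _) -0#≈0# (neg-antitone a≤0)

  *-monoˡ-≤ : ∀ {a b} c → 0ℝ ≤ c → a ≤ b → c * a ≤ c * b
  *-monoˡ-≤ {a} {b} c 0≤c a≤b = nonneg-sub (subst (0ℝ ≤_)
    (solve 3 (λ a b c → c :* (b :- a) := c :* b :- c :* a) refl a b c)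
    (*-nonneg 0≤c (sub-nonneg a≤b)))

  square-nonneg : ∀ a → 0ℝ ≤ a * a
  square-nonneg a with ≤-total 0ℝ a
  ... | inj₁ 0≤a = *-nonneg 0≤a 0≤a
  ... | inj₂ a≤0 = subst (0ℝ ≤_) (solve 1 (λ a → (:- a) :* (:- a) := a :* a) refl a)
                         (*-nonneg (nonpos⇒neg-nonneg a≤0) (nonpos⇒neg-nonneg a≤0))

  0≤1 : 0ℝ ≤ 1ℝ
  0≤1 = subst (0ℝ ≤_) (*-identityʳ 1ℝ) (square-nonneg 1ℝ)

  0≤fromℕ : ∀ n → 0ℝ ≤ fromℕ n
  0≤fromℕ zero    = ≤-refl 0ℝ
  0≤fromℕ (suc n) = subst (_≤ 1ℝ + fromℕ n) (+-identityʳ 0ℝ) (≤-add 0≤1 (0≤fromℕ n))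

  fromℕ-suc≢0 : ∀ n → ¬ (fromℕ (suc n) ≡ 0ℝ)
  fromℕ-suc≢0 n eq = 0≢1 (≤-antisym 0≤1 (subst (1ℝ ≤_) eq 1≤1+n))
    where
    1≤1+n : 1ℝ ≤ 1ℝ + fromℕ n
    1≤1+n = subst (_≤ 1ℝ + fromℕ n) (+-identityʳ 1ℝ) (≤-addˡ 1ℝ (0≤fromℕ n))

  nonneg-sum≡0 : ∀ {a b} → 0ℝ ≤ a → 0ℝ ≤ b → a + b ≡ 0ℝ → a ≡ 0ℝ
  nonneg-sum≡0 {a} {b} 0≤a 0≤b a+b≡0 = ≤-antisym
    (subst (a ≤_) a+b≡0 (subst (_≤ a + b) (+-identityʳ a) (≤-addˡ a 0≤b))) 0≤a

  -- If r ≥ 0 and r² = 0 then every multiple n·r is at most 1, so the supremum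
  -- l of these multiples satisfies l ≤ l - r, i.e. r ≤ 0.
  nonneg-square≡0 : ∀ r → 0ℝ ≤ r → r * r ≡ 0ℝ → r ≤ 0ℝ
  nonneg-square≡0 r 0≤r r²≡0 = subst₂ _≤_
      (solve 2 (λ l r → l :+ (r :- l) := r) refl l r)
      (solve 2 (λ l r → (l :- r) :+ (r :- l) := κ 0) refl l r)
      (+-mono-≤ (r - l) (proj₂ (proj₂ supremum) (l - r) shifted-bound))
    where
    Multiple : ℝ → Set
    Multiple z = Σ ℕ (λ n → z ≡ fromℕ n * r)

    multiple≤1 : ∀ n → fromℕ n * r ≤ 1ℝ
    multiple≤1 n with ≤-total (fromℕ n * r) 1ℝ
    ... | inj₁ z≤1 = z≤1
    ... | inj₂ 1≤z = ⊥-elim (0≢1 (≤-antisym 0≤1 (subst (1ℝ ≤_) z²≡0 1≤z²)))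
      where
      z = fromℕ n * r
      1≤z² : 1ℝ ≤ z * z
      1≤z² = ≤-trans 1≤z (subst (_≤ z * z) (*-identityʳ z) (*-monoˡ-≤ z (≤-trans 0≤1 1≤z) 1≤z))
      z²≡0 : z * z ≡ 0ℝ
      z²≡0 = begin
        z * z                           ≡⟨ solve 2 (λ N r → (N :* r) :* (N :* r) := (N :* N) :* (r :* r)) refl (fromℕ n) r ⟩
        (fromℕ n * fromℕ n) * (r * r)   ≡⟨ cong ((fromℕ n * fromℕ n) *_) r²≡0 ⟩
        (fromℕ n * fromℕ n) * 0ℝ        ≡⟨ zeroʳ _ ⟩
        0ℝ                              ∎

    supremum = sup Multiple (0ℝ , 0 , sym (zeroˡ r)) (1ℝ , λ { z (n , refl) → multiple≤1 n })
    l = proj₁ supremum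

    shifted-bound : ∀ z → Multiple z → z ≤ l - r
    shifted-bound z (n , refl) = subst (_≤ l - r)
      (trans (cong (λ o → o * r - r) (fromℕ-+ 1 n))
             (solve 2 (λ N r → (κ 1 :+ N) :* r :- r := N :* r) refl (fromℕ n) r))
      (+-mono-≤ (- r) (proj₁ (proj₂ supremum) (fromℕ (suc n) * r) (suc n , refl)))

  square≡0 : ∀ a → a * a ≡ 0ℝ → a ≡ 0ℝ
  square≡0 a a²≡0 with ≤-total 0ℝ a
  ... | inj₁ 0≤a = ≤-antisym (nonneg-square≡0 a 0≤a a²≡0) 0≤a
  ... | inj₂ a≤0 = begin
    a       ≡⟨ sym (-‿involutive a) ⟩
    - (- a) ≡⟨ cong (λ z → - z) (≤-antisym (nonneg-square≡0 (- a) 0≤-a -a²≡0) 0≤-a) ⟩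
    - 0ℝ    ≡⟨ -0#≈0# ⟩
    0ℝ      ∎
    where
    0≤-a = nonpos⇒neg-nonneg a≤0
    -a²≡0 = trans (solve 1 (λ a → (:- a) :* (:- a) := a :* a) refl a) a²≡0

module RealFieldFractions (R : RealField) where
  open RealField R
  open Linear R using (fromℕ)
  open RealFieldArithmetic R
  open RealFieldOrder R
  open ≡-Reasoning

  inverseʳ : ∀ n → fromℕ (suc n) * fromℕ (suc n) ⁻¹ ≡ fromℕ 1
  inverseʳ n = trans (*-comm _ _) (trans (*-inverseˡ _ (fromℕ-suc≢0 n)) (sym fromℕ-1))

  cancel-fromℕ : ∀ n {a b} → fromℕ (suc n) * a ≡ fromℕ (suc n) * b → a ≡ b
  cancel-fromℕ n {a} {b} eq = begin
    a             ≡⟨ solve 1 (λ a → a := κ 1 :* a) refl a ⟩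
    fromℕ 1 * a   ≡⟨ cong (_* a) (sym (trans (*-comm _ _) (inverseʳ n))) ⟩
    (N⁻¹ * N) * a ≡⟨ *-assoc N⁻¹ N a ⟩
    N⁻¹ * (N * a) ≡⟨ cong (N⁻¹ *_) eq ⟩
    N⁻¹ * (N * b) ≡⟨ sym (*-assoc N⁻¹ N b) ⟩
    (N⁻¹ * N) * b ≡⟨ cong (_* b) (trans (*-comm _ _) (inverseʳ n)) ⟩
    fromℕ 1 * b   ≡⟨ solve 1 (λ b → κ 1 :* b := b) refl b ⟩
    b             ∎
    where
    N = fromℕ (suc n)
    N⁻¹ = N ⁻¹

  inverse-unique : ∀ n a → fromℕ (suc n) * a ≡ fromℕ 1 → fromℕ (suc n) ⁻¹ ≡ a
  inverse-unique n a eq = cancel-fromℕ n (trans (inverseʳ n) (sym eq))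

  half third : ℝ
  half  = fromℕ 2 ⁻¹
  third = fromℕ 3 ⁻¹

  2*half : fromℕ 2 * half ≡ fromℕ 1
  2*half = inverseʳ 1

  3*third : fromℕ 3 * third ≡ fromℕ 1
  3*third = inverseʳ 2

  1*1 : fromℕ 1 * fromℕ 1 ≡ fromℕ 1
  1*1 = solve 0 (κ 1 :* κ 1 := κ 1) refl

  quarter≡half² : fromℕ 4 ⁻¹ ≡ half * half
  quarter≡half² = inverse-unique 3 (half * half) (begin
    fromℕ 4 * (half * half)               ≡⟨ solve 1 (λ h → κ 4 :* (h :* h) := (κ 2 :* h) :* (κ 2 :* h)) refl half ⟩
    (fromℕ 2 * half) * (fromℕ 2 * half)   ≡⟨ cong₂ _*_ 2*half 2*half ⟩
    fromℕ 1 * fromℕ 1                     ≡⟨ 1*1 ⟩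
    fromℕ 1                               ∎)

  ninth≡third² : fromℕ 9 ⁻¹ ≡ third * third
  ninth≡third² = inverse-unique 8 (third * third) (begin
    fromℕ 9 * (third * third)               ≡⟨ solve 1 (λ t → κ 9 :* (t :* t) := (κ 3 :* t) :* (κ 3 :* t)) refl third ⟩
    (fromℕ 3 * third) * (fromℕ 3 * third)   ≡⟨ cong₂ _*_ 3*third 3*third ⟩
    fromℕ 1 * fromℕ 1                       ≡⟨ 1*1 ⟩
    fromℕ 1                                 ∎)

  -- Evaluating an expression e in half and third by clearing denominators:
  -- if N·e is a polynomial P in 2·half and 3·third, then N·e = P(1,1).
  clear-denominators : ∀ n {e c} (P : ℝ → ℝ → ℝ) →
    fromℕ (suc n) * e ≡ P (fromℕ 2 * half) (fromℕ 3 * third) →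
    P (fromℕ 1) (fromℕ 1) ≡ fromℕ (suc n) * c → e ≡ c
  clear-denominators n P expand evaluate =
    cancel-fromℕ n (trans expand (trans (cong₂ P 2*half 3*third) evaluate))

  ⟦⟧ℤ-injective : ∀ i j → ⟦ i ⟧ℤ ≡ ⟦ j ⟧ℤ → i ≡ j
  ⟦⟧ℤ-injective i j eq = ℤₚ.i-j≡0⇒i≡j i j (kernel-trivial (i ℤ.- j) (begin
    ⟦ i ℤ.+ ℤ.- j ⟧ℤ    ≡⟨ +-hom i (ℤ.- j) ⟩
    ⟦ i ⟧ℤ + ⟦ ℤ.- j ⟧ℤ ≡⟨ cong₂ _+_ eq (neg-hom j) ⟩
    ⟦ j ⟧ℤ - ⟦ j ⟧ℤ     ≡⟨ +-inverseʳ _ ⟩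
    0ℝ                  ∎))
    where
    kernel-trivial : ∀ k → ⟦ k ⟧ℤ ≡ 0ℝ → k ≡ ℤ.+ 0
    kernel-trivial (ℤ.+ zero)  _  = refl
    kernel-trivial (ℤ.+ suc n) eq = ⊥-elim (fromℕ-suc≢0 n eq)
    kernel-trivial -[1+ n ]    eq = ⊥-elim (fromℕ-suc≢0 n (begin
      fromℕ (suc n)         ≡⟨ sym (-‿involutive _) ⟩
      - (- fromℕ (suc n))   ≡⟨ cong (λ z → - z) eq ⟩
      - 0ℝ                  ≡⟨ -0#≈0# ⟩
      0ℝ                    ∎))

module FiniteSums (R : RealField) where
  open RealField R
  open Linear R using (fromℕ; ∑)
  open RealFieldArithmetic R
  open RealFieldOrder R
  open ≡-Reasoning

  open SemiringSum (CommutativeRing.semiring commutativeRing) using (sum; sum-remove)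

  ∑≡sum : ∀ {n} (f : Fin n → ℝ) → ∑ f ≡ sum f
  ∑≡sum {zero}  f = refl
  ∑≡sum {suc n} f = cong (f zero +_) (∑≡sum (λ i → f (suc i)))

  ∑-remove : ∀ {n} (f : Fin (suc n) → ℝ) a → ∑ f ≡ f a + ∑ (λ k → f (punchIn a k))
  ∑-remove f a = begin
    ∑ f                              ≡⟨ ∑≡sum f ⟩
    sum f                            ≡⟨ sum-remove {i = a} f ⟩
    f a + sum (λ k → f (punchIn a k)) ≡⟨ cong (f a +_) (sym (∑≡sum (λ k → f (punchIn a k)))) ⟩
    f a + ∑ (λ k → f (punchIn a k))  ∎

  ∑-cong : ∀ {n} {f g : Fin n → ℝ} → (∀ i → f i ≡ g i) → ∑ f ≡ ∑ g
  ∑-cong {zero}  f≗g = refl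
  ∑-cong {suc n} f≗g = cong₂ _+_ (f≗g zero) (∑-cong (λ i → f≗g (suc i)))

  ∑-+ : ∀ {n} (f g : Fin n → ℝ) → ∑ (λ i → f i + g i) ≡ ∑ f + ∑ g
  ∑-+ {zero}  f g = sym (+-identityʳ 0ℝ)
  ∑-+ {suc n} f g = trans (cong ((f zero + g zero) +_) (∑-+ (λ i → f (suc i)) (λ i → g (suc i))))
    (solve 4 (λ a b c d → (a :+ b) :+ (c :+ d) := (a :+ c) :+ (b :+ d)) refl _ _ _ _)

  ∑-*ˡ : ∀ {n} a (f : Fin n → ℝ) → ∑ (λ i → a * f i) ≡ a * ∑ f
  ∑-*ˡ {zero}  a f = sym (zeroʳ a)
  ∑-*ˡ {suc n} a f = trans (cong ((a * f zero) +_) (∑-*ˡ a (λ i → f (suc i)))) (sym (distribˡ _ _ _))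

  ∑-zero : ∀ {n} (f : Fin n → ℝ) → (∀ i → f i ≡ 0ℝ) → ∑ f ≡ 0ℝ
  ∑-zero {zero}  f f≡0 = refl
  ∑-zero {suc n} f f≡0 =
    trans (cong₂ _+_ (f≡0 zero) (∑-zero (λ i → f (suc i)) (λ i → f≡0 (suc i)))) (+-identityʳ 0ℝ)

  ∑-neg : ∀ {n} (f : Fin n → ℝ) → ∑ (λ i → - f i) ≡ - ∑ f
  ∑-neg {zero}  f = sym -0#≈0#
  ∑-neg {suc n} f = trans (cong ((- f zero) +_) (∑-neg (λ i → f (suc i)))) (-‿+-comm _ _)

  ∑-mono : ∀ {n} (f g : Fin n → ℝ) → (∀ i → f i ≤ g i) → ∑ f ≤ ∑ g
  ∑-mono {zero}  f g f≤g = ≤-refl 0ℝ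
  ∑-mono {suc n} f g f≤g = ≤-add (f≤g zero) (∑-mono _ _ (λ i → f≤g (suc i)))

  ∑≤term : ∀ {n} (f : Fin (suc n) → ℝ) a → (∀ i → ¬ i ≡ a → f i ≤ 0ℝ) → ∑ f ≤ f a
  ∑≤term {n} f a others≤0 = subst₂ _≤_ (sym (∑-remove f a)) (+-identityʳ (f a))
    (≤-addˡ (f a) (subst (∑ (λ k → f (punchIn a k)) ≤_) (∑-zero {n} (λ _ → 0ℝ) (λ _ → refl))
      (∑-mono _ _ (λ k → others≤0 (punchIn a k) (Finₚ.punchInᵢ≢i a k)))))

  point : ∀ {n} → Fin n → ℝ → Fin n → ℝ
  point a v i = if does (i ≟ a) then v else 0ℝ

  point-at : ∀ {n} (a : Fin n) v → point a v a ≡ v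
  point-at a v rewrite dec-true (a ≟ a) refl = refl

  point-off : ∀ {n} {a i : Fin n} v → ¬ i ≡ a → point a v i ≡ 0ℝ
  point-off {a = a} {i} v i≢a rewrite dec-false (i ≟ a) i≢a = refl

  ∑-point : ∀ {n} (a : Fin (suc n)) v → ∑ (point a v) ≡ v
  ∑-point a v = begin
    ∑ (point a v)                                             ≡⟨ ∑-remove (point a v) a ⟩
    point a v a + ∑ (λ k → point a v (punchIn a k))       ≡⟨ cong₂ _+_ (point-at a v) (∑-zero _ (λ k → point-off v (Finₚ.punchInᵢ≢i a k))) ⟩
    v + 0ℝ                                                    ≡⟨ +-identityʳ v ⟩
    v                                                         ∎

  support₃-decomposition : ∀ {n} (f : Fin n → ℝ) a b e → ¬ a ≡ b → ¬ a ≡ e → ¬ b ≡ e →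
    (∀ i → ¬ i ≡ a → ¬ i ≡ b → ¬ i ≡ e → f i ≡ 0ℝ) →
    ∀ i → f i ≡ point a (f a) i + (point b (f b) i + point e (f e) i)
  support₃-decomposition f a b e a≢b a≢e b≢e outside i = by-cases (i ≟ a) (i ≟ b) (i ≟ e)
    where
    by-cases : Dec (i ≡ a) → Dec (i ≡ b) → Dec (i ≡ e) →
               f i ≡ point a (f a) i + (point b (f b) i + point e (f e) i)
    by-cases (yes refl) _ _ = sym (begin
      point i (f i) i + (point b (f b) i + point e (f e) i)
        ≡⟨ cong₂ (λ x y → x + (y + point e (f e) i)) (point-at i (f i)) (point-off _ a≢b) ⟩
      f i + (0ℝ + point e (f e) i)   ≡⟨ cong (λ y → f i + (0ℝ + y)) (point-off _ a≢e) ⟩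
      f i + (0ℝ + 0ℝ)                ≡⟨ solve 1 (λ x → x :+ (κ 0 :+ κ 0) := x) refl (f i) ⟩
      f i                            ∎)
    by-cases (no i≢a) (yes refl) _ = sym (begin
      point a (f a) i + (point i (f i) i + point e (f e) i)
        ≡⟨ cong₂ (λ x y → x + (y + point e (f e) i)) (point-off _ i≢a) (point-at i (f i)) ⟩
      0ℝ + (f i + point e (f e) i)   ≡⟨ cong (λ y → 0ℝ + (f i + y)) (point-off _ b≢e) ⟩
      0ℝ + (f i + 0ℝ)                ≡⟨ solve 1 (λ x → κ 0 :+ (x :+ κ 0) := x) refl (f i) ⟩
      f i                            ∎)
    by-cases (no i≢a) (no i≢b) (yes refl) = sym (begin
      point a (f a) i + (point b (f b) i + point i (f i) i)
        ≡⟨ cong₂ (λ x y → x + (y + point i (f i) i)) (point-off _ i≢a) (point-off _ i≢b) ⟩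
      0ℝ + (0ℝ + point i (f i) i)    ≡⟨ cong (λ y → 0ℝ + (0ℝ + y)) (point-at i (f i)) ⟩
      0ℝ + (0ℝ + f i)                ≡⟨ solve 1 (λ x → κ 0 :+ (κ 0 :+ x) := x) refl (f i) ⟩
      f i                            ∎)
    by-cases (no i≢a) (no i≢b) (no i≢e) = begin
      f i                            ≡⟨ outside i i≢a i≢b i≢e ⟩
      0ℝ                             ≡⟨ solve 0 (κ 0 := κ 0 :+ (κ 0 :+ κ 0)) refl ⟩
      0ℝ + (0ℝ + 0ℝ)                 ≡⟨ sym (cong₂ (λ x y → x + (y + point e (f e) i)) (point-off _ i≢a) (point-off _ i≢b)
                                         ⟨ trans ⟩ cong (λ y → 0ℝ + (0ℝ + y)) (point-off _ i≢e)) ⟩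
      point a (f a) i + (point b (f b) i + point e (f e) i) ∎

  ∑-support₃ : ∀ {n} (f : Fin (suc n) → ℝ) a b e → ¬ a ≡ b → ¬ a ≡ e → ¬ b ≡ e →
               (∀ i → ¬ i ≡ a → ¬ i ≡ b → ¬ i ≡ e → f i ≡ 0ℝ) → ∑ f ≡ f a + (f b + f e)
  ∑-support₃ f a b e a≢b a≢e b≢e outside = begin
    ∑ f                                                    ≡⟨ ∑-cong (support₃-decomposition f a b e a≢b a≢e b≢e outside) ⟩
    ∑ (λ i → point a (f a) i + (point b (f b) i + point e (f e) i))
      ≡⟨ trans (∑-+ (point a (f a)) (λ i → point b (f b) i + point e (f e) i)) (cong (∑ (point a (f a)) +_) (∑-+ (point b (f b)) (point e (f e)))) ⟩
    ∑ (point a (f a)) + (∑ (point b (f b)) + ∑ (point e (f e)))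
      ≡⟨ cong₂ _+_ (∑-point a _) (cong₂ _+_ (∑-point b _) (∑-point e _)) ⟩
    f a + (f b + f e)                                      ∎

  ∑-select-const : ∀ {n} (sel : Fin n → Bool) c →
                   ∑ (λ i → if sel i then c else 0ℝ) ≡ c * fromℕ (count sel)
  ∑-select-const {zero}  sel c = sym (zeroʳ c)
  ∑-select-const {suc n} sel c with sel zero
  ... | true  = begin
    c + ∑ (λ i → if sel (suc i) then c else 0ℝ)   ≡⟨ cong (c +_) (∑-select-const (λ i → sel (suc i)) c) ⟩
    c + c * fromℕ (count (λ i → sel (suc i)))     ≡⟨ sym (trans (distribˡ c 1ℝ _) (cong (_+ c * fromℕ (count (λ i → sel (suc i)))) (*-identityʳ c))) ⟩
    c * (1ℝ + fromℕ (count (λ i → sel (suc i))))  ∎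
  ... | false = trans (+-identityˡ _) (∑-select-const (λ i → sel (suc i)) c)

module InnerProducts (R : RealField) where
  open RealField R
  open Linear R
  open RealFieldArithmetic R
  open RealFieldOrder R
  open FiniteSums R
  open ≡-Reasoning

  selectedSum : ∀ {d n} → (Fin n → Bool) → (Fin n → Vec d) → Vec d
  selectedSum sel g = ∑ᵛ (λ i → if sel i then g i else (λ _ → 0ℝ))

  ⟪⟫-cong : ∀ {d} {x x′ y y′ : Vec d} → (∀ k → x k ≡ x′ k) → (∀ k → y k ≡ y′ k) →
            ⟪ x , y ⟫ ≡ ⟪ x′ , y′ ⟫
  ⟪⟫-cong x≗x′ y≗y′ = ∑-cong (λ k → cong₂ _*_ (x≗x′ k) (y≗y′ k))

  ⟪⟫-sym : ∀ {d} (x y : Vec d) → ⟪ x , y ⟫ ≡ ⟪ y , x ⟫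
  ⟪⟫-sym x y = ∑-cong (λ k → *-comm (x k) (y k))

  ⟪·⟫ : ∀ {d} a (x z : Vec d) → ⟪ a · x , z ⟫ ≡ a * ⟪ x , z ⟫
  ⟪·⟫ a x z = trans (∑-cong (λ k → *-assoc a (x k) (z k))) (∑-*ˡ a (λ k → x k * z k))

  ⟪+⟫ : ∀ {d} (x y z : Vec d) → ⟪ x +ᵛ y , z ⟫ ≡ ⟪ x , z ⟫ + ⟪ y , z ⟫
  ⟪+⟫ x y z = trans (∑-cong (λ k → distribʳ (z k) (x k) (y k))) (∑-+ (λ k → x k * z k) (λ k → y k * z k))

  ⟪-⟫ : ∀ {d} (x y z : Vec d) → ⟪ x -ᵛ y , z ⟫ ≡ ⟪ x , z ⟫ - ⟪ y , z ⟫
  ⟪-⟫ x y z = begin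
    ∑ (λ k → (x k + - y k) * z k)         ≡⟨ ∑-cong (λ k → trans (distribʳ (z k) (x k) (- y k))
                                                        (cong (x k * z k +_) (sym (-‿distribˡ-* (y k) (z k))))) ⟩
    ∑ (λ k → x k * z k + - (y k * z k))   ≡⟨ ∑-+ (λ k → x k * z k) (λ k → - (y k * z k)) ⟩
    ⟪ x , z ⟫ + ∑ (λ k → - (y k * z k))   ≡⟨ cong (⟪ x , z ⟫ +_) (∑-neg (λ k → y k * z k)) ⟩
    ⟪ x , z ⟫ - ⟪ y , z ⟫                 ∎

  ⟪combination⟫ : ∀ {d} α β γ δ (x u y v : Vec d) →
    ⟪ α · x +ᵛ β · u , γ · y +ᵛ δ · v ⟫ ≡
    α * (γ * ⟪ x , y ⟫ + δ * ⟪ x , v ⟫) + β * (γ * ⟪ u , y ⟫ + δ * ⟪ u , v ⟫)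
  ⟪combination⟫ α β γ δ x u y v = begin
    ⟪ α · x +ᵛ β · u , w ⟫              ≡⟨ ⟪+⟫ (α · x) (β · u) w ⟩
    ⟪ α · x , w ⟫ + ⟪ β · u , w ⟫      ≡⟨ cong₂ _+_ (⟪·⟫ α x w) (⟪·⟫ β u w) ⟩
    α * ⟪ x , w ⟫ + β * ⟪ u , w ⟫      ≡⟨ cong₂ (λ a b → α * a + β * b) (expand x) (expand u) ⟩
    α * (γ * ⟪ x , y ⟫ + δ * ⟪ x , v ⟫) + β * (γ * ⟪ u , y ⟫ + δ * ⟪ u , v ⟫) ∎
    where
    w = γ · y +ᵛ δ · v
    expand : ∀ z → ⟪ z , w ⟫ ≡ γ * ⟪ z , y ⟫ + δ * ⟪ z , v ⟫
    expand z = begin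
      ⟪ z , w ⟫                       ≡⟨ ⟪⟫-sym z w ⟩
      ⟪ γ · y +ᵛ δ · v , z ⟫          ≡⟨ ⟪+⟫ (γ · y) (δ · v) z ⟩
      ⟪ γ · y , z ⟫ + ⟪ δ · v , z ⟫   ≡⟨ cong₂ _+_ (⟪·⟫ γ y z) (⟪·⟫ δ v z) ⟩
      γ * ⟪ y , z ⟫ + δ * ⟪ v , z ⟫   ≡⟨ cong₂ (λ a b → γ * a + δ * b) (⟪⟫-sym y z) (⟪⟫-sym v z) ⟩
      γ * ⟪ z , y ⟫ + δ * ⟪ z , v ⟫   ∎

  ⟪∑ᵛ⟫ : ∀ {d n} (f : Fin n → Vec d) (z : Vec d) → ⟪ ∑ᵛ f , z ⟫ ≡ ∑ (λ i → ⟪ f i , z ⟫)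
  ⟪∑ᵛ⟫ {n = zero}  f z = ∑-zero _ (λ k → zeroˡ (z k))
  ⟪∑ᵛ⟫ {n = suc n} f z = begin
    ⟪ f zero +ᵛ ∑ᵛ (λ i → f (suc i)) , z ⟫             ≡⟨ ⟪+⟫ (f zero) (∑ᵛ (λ i → f (suc i))) z ⟩
    ⟪ f zero , z ⟫ + ⟪ ∑ᵛ (λ i → f (suc i)) , z ⟫      ≡⟨ cong (⟪ f zero , z ⟫ +_) (⟪∑ᵛ⟫ (λ i → f (suc i)) z) ⟩
    ⟪ f zero , z ⟫ + ∑ (λ i → ⟪ f (suc i) , z ⟫)       ∎

  ⟪selectedSum⟫ : ∀ {d n} (sel : Fin n → Bool) (g : Fin n → Vec d) (z : Vec d) →
    ⟪ selectedSum sel g , z ⟫ ≡ ∑ (λ i → if sel i then ⟪ g i , z ⟫ else 0ℝ)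
  ⟪selectedSum⟫ sel g z = trans (⟪∑ᵛ⟫ (λ i → if sel i then g i else (λ _ → 0ℝ)) z) (∑-cong (λ i → selected (sel i)))
    where
    selected : ∀ {i} b → ⟪ (if b then g i else (λ _ → 0ℝ)) , z ⟫ ≡ (if b then ⟪ g i , z ⟫ else 0ℝ)
    selected true  = refl
    selected false = ∑-zero _ (λ k → zeroˡ (z k))

  ⟪⟫-nonneg : ∀ {d} (x : Vec d) → 0ℝ ≤ ⟪ x , x ⟫
  ⟪⟫-nonneg {zero}  x = ≤-refl 0ℝ
  ⟪⟫-nonneg {suc d} x = subst (_≤ ⟪ x , x ⟫) (+-identityʳ 0ℝ)
    (≤-add (square-nonneg (x zero)) (⟪⟫-nonneg (λ k → x (suc k))))

  ⟪⟫≡0⇒zero : ∀ {d} (x : Vec d) → ⟪ x , x ⟫ ≡ 0ℝ → ∀ k → x k ≡ 0ℝ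
  ⟪⟫≡0⇒zero {suc d} x eq zero    =
    square≡0 _ (nonneg-sum≡0 (square-nonneg (x zero)) (⟪⟫-nonneg (λ k → x (suc k))) eq)
  ⟪⟫≡0⇒zero {suc d} x eq (suc k) = ⟪⟫≡0⇒zero (λ k → x (suc k))
    (nonneg-sum≡0 (⟪⟫-nonneg (λ k → x (suc k))) (square-nonneg (x zero)) (trans (+-comm _ _) eq)) k

  orthProj-inner : ∀ {d n} (g : Fin n → Vec d) (y p : Vec d) → IsOrthProj g y p →
                   ∀ i → ⟪ p , g i ⟫ ≡ ⟪ y , g i ⟫
  orthProj-inner g y p (_ , y-p⊥g) i = sym (begin
    ⟪ y , g i ⟫                                   ≡⟨ solve 2 (λ a b → a := (a :- b) :+ b) refl _ _ ⟩
    (⟪ y , g i ⟫ - ⟪ p , g i ⟫) + ⟪ p , g i ⟫     ≡⟨ cong (_+ ⟪ p , g i ⟫) (trans (sym (⟪-⟫ y p (g i))) (y-p⊥g i)) ⟩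
    0ℝ + ⟪ p , g i ⟫                              ≡⟨ +-identityˡ _ ⟩
    ⟪ p , g i ⟫                                   ∎)

  -- If ⟪p,q⟫ = a and ⟪q,q⟫ ≤ a, then ⟪p,p⟫ ≥ a, with equality only for p = q:
  -- indeed 0 ≤ ⟪p-q,p-q⟫ = (⟪p,p⟫ - a) + (⟪q,q⟫ - a).
  norm-comparison : ∀ {d} (p q : Vec d) a → ⟪ p , q ⟫ ≡ a → ⟪ q , q ⟫ ≤ a →
    a ≤ ⟪ p , p ⟫ × (⟪ p , p ⟫ ≡ a → ∀ k → p k ≡ q k)
  norm-comparison p q a pq≡a qq≤a = lower , equality
    where
    P = ⟪ p , p ⟫
    Q = ⟪ q , q ⟫
    expansion : ⟪ p -ᵛ q , p -ᵛ q ⟫ ≡ (P - a) + (Q - a)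
    expansion = begin
      ⟪ p -ᵛ q , p -ᵛ q ⟫                      ≡⟨ ⟪-⟫ p q (p -ᵛ q) ⟩
      ⟪ p , p -ᵛ q ⟫ - ⟪ q , p -ᵛ q ⟫          ≡⟨ cong₂ _-_ (trans (⟪⟫-sym p (p -ᵛ q)) (⟪-⟫ p q p))
                                                          (trans (⟪⟫-sym q (p -ᵛ q)) (⟪-⟫ p q q)) ⟩
      (P - ⟪ q , p ⟫) - (⟪ p , q ⟫ - Q)        ≡⟨ cong₂ (λ b c → (P - b) - (c - Q)) (trans (⟪⟫-sym q p) pq≡a) pq≡a ⟩
      (P - a) - (a - Q)                        ≡⟨ solve 3 (λ P Q a → (P :- a) :- (a :- Q) := (P :- a) :+ (Q :- a)) refl P Q a ⟩
      (P - a) + (Q - a)                        ∎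
    Q-a≤0 : Q - a ≤ 0ℝ
    Q-a≤0 = subst (Q - a ≤_) (+-inverseʳ a) (+-mono-≤ (- a) qq≤a)
    0≤P-a : 0ℝ ≤ P - a
    0≤P-a = ≤-trans (subst (0ℝ ≤_) expansion (⟪⟫-nonneg (p -ᵛ q)))
                    (subst ((P - a) + (Q - a) ≤_) (+-identityʳ _) (≤-addˡ _ Q-a≤0))
    lower : a ≤ P
    lower = nonneg-sub 0≤P-a
    equality : P ≡ a → ∀ k → p k ≡ q k
    equality P≡a k = solve 2 (λ x y → x := (x :- y) :+ y) refl (p k) (q k)
      ⟨ trans ⟩ cong (_+ q k) (⟪⟫≡0⇒zero (p -ᵛ q) d≡0 k) ⟨ trans ⟩ +-identityˡ (q k)
      where
      d≡0 : ⟪ p -ᵛ q , p -ᵛ q ⟫ ≡ 0ℝ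
      d≡0 = ≤-antisym
        (subst (_≤ 0ℝ) (sym (expansion ⟨ trans ⟩ cong (λ b → (b - a) + (Q - a)) P≡a
                              ⟨ trans ⟩ cong (_+ (Q - a)) (+-inverseʳ a) ⟨ trans ⟩ +-identityˡ _)) Q-a≤0)
        (⟪⟫-nonneg (p -ᵛ q))

  selectedSum-norm≤ : ∀ {d n} (g : Fin (suc n) → Vec d) δ (sel : Fin (suc n) → Bool) →
    (∀ i → ⟪ g i , g i ⟫ ≡ δ) → (∀ i j → ¬ i ≡ j → ⟪ g i , g j ⟫ ≤ 0ℝ) →
    ⟪ selectedSum sel g , selectedSum sel g ⟫ ≤ δ * fromℕ (count sel)
  selectedSum-norm≤ g δ sel diagonal off-diagonal =
    subst₂ _≤_ (sym (⟪selectedSum⟫ sel g S′)) (∑-select-const sel δ)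
      (∑-mono _ _ term≤)
    where
    S′ = selectedSum sel g
    selected-or-0 : ∀ j i → ¬ j ≡ i → (if sel j then ⟪ g j , g i ⟫ else 0ℝ) ≤ 0ℝ
    selected-or-0 j i j≢i with sel j
    ... | true  = off-diagonal j i j≢i
    ... | false = ≤-refl 0ℝ
    -- ⟪gᵢ,S⟫ ≤ ⟪gᵢ,gᵢ⟫ = δ, since the other terms of ⟪gᵢ,S⟫ are non-positive
    term≤ : ∀ i → (if sel i then ⟪ g i , S′ ⟫ else 0ℝ) ≤ (if sel i then δ else 0ℝ)
    term≤ i with sel i in sel-i
    ... | false = ≤-refl 0ℝ
    ... | true  = subst₂ _≤_ (sym (trans (⟪⟫-sym (g i) S′) (⟪selectedSum⟫ sel g (g i))))
                             (trans (cong (λ b → if b then ⟪ g i , g i ⟫ else 0ℝ) sel-i) (diagonal i))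
                             (∑≤term _ i (λ j j≢i → selected-or-0 j i j≢i))

module HatInnerProducts (R : RealField) where
  open RealField R
  open Linear R using (fromℕ)
  open RealFieldArithmetic R
  open RealFieldFractions R
  open ≡-Reasoning

  three-halves : ℝ
  three-halves = fromℕ 3 * half

  -- ⟪v̂,v̂′⟫ for v, v′ ∈ G₁(u), where X = ⟪x_v,x_v′⟫ (using ⟪x_v,x_u⟫ = -1/3)
  gram₁ : ℝ → ℝ
  gram₁ X = three-halves * (three-halves * X + half * (- third))
          + half * (three-halves * (- third) + half * fromℕ 1)

  -- ⟪ŵ,v̂⟫ for w ∈ G₂(u), v ∈ G₁(u), where X = ⟪x_w,x_v⟫ (using ⟪x_w,x_u⟫ = 1/9)
  gram₂ : ℝ → ℝ
  gram₂ X = (fromℕ 9 * (half * half)) * (three-halves * X + half * (third * third))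
          + (- (half * half)) * (three-halves * (- third) + half * fromℕ 1)

  gram₁-equal : gram₁ (fromℕ 1) ≡ fromℕ 2
  gram₁-equal = clear-denominators 11 (λ H T → fromℕ 30 * H * H - fromℕ 6 * H * H * T)
    (solve 2 (λ h t → κ 12 :* ((κ 3 :* h) :* ((κ 3 :* h) :* κ 1 :+ h :* (:- t)) :+ h :* ((κ 3 :* h) :* (:- t) :+ h :* κ 1))
                   := κ 30 :* (κ 2 :* h) :* (κ 2 :* h) :- κ 6 :* (κ 2 :* h) :* (κ 2 :* h) :* (κ 3 :* t)) refl half third)
    (solve 0 (κ 30 :* κ 1 :* κ 1 :- κ 6 :* κ 1 :* κ 1 :* κ 1 := κ 12 :* κ 2) refl)

  gram₁-adjacent : gram₁ (- third) ≡ - fromℕ 1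
  gram₁-adjacent = clear-denominators 11 (λ H T → fromℕ 3 * H * H - fromℕ 15 * H * H * T)
    (solve 2 (λ h t → κ 12 :* ((κ 3 :* h) :* ((κ 3 :* h) :* (:- t) :+ h :* (:- t)) :+ h :* ((κ 3 :* h) :* (:- t) :+ h :* κ 1))
                   := κ 3 :* (κ 2 :* h) :* (κ 2 :* h) :- κ 15 :* (κ 2 :* h) :* (κ 2 :* h) :* (κ 3 :* t)) refl half third)
    (solve 0 (κ 3 :* κ 1 :* κ 1 :- κ 15 :* κ 1 :* κ 1 :* κ 1 := κ 12 :* (:- κ 1)) refl)

  gram₁-distant : gram₁ (third * third) ≡ 0ℝ
  gram₁-distant = clear-denominators 35
    (λ H T → fromℕ 9 * H * H * T * T - fromℕ 18 * H * H * T + fromℕ 9 * H * H)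
    (solve 2 (λ h t → κ 36 :* ((κ 3 :* h) :* ((κ 3 :* h) :* (t :* t) :+ h :* (:- t)) :+ h :* ((κ 3 :* h) :* (:- t) :+ h :* κ 1))
                   := κ 9 :* (κ 2 :* h) :* (κ 2 :* h) :* (κ 3 :* t) :* (κ 3 :* t)
                      :- κ 18 :* (κ 2 :* h) :* (κ 2 :* h) :* (κ 3 :* t) :+ κ 9 :* (κ 2 :* h) :* (κ 2 :* h)) refl half third)
    (solve 0 (κ 9 :* κ 1 :* κ 1 :* κ 1 :* κ 1 :- κ 18 :* κ 1 :* κ 1 :* κ 1 :+ κ 9 :* κ 1 :* κ 1 := κ 36 :* κ 0) refl)

  gram₂-adjacent : gram₂ (- third) ≡ - fromℕ 1
  gram₂-adjacent = clear-denominators 71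
    (λ H T → fromℕ 9 * H * H * H * T * T - fromℕ 72 * H * H * H * T - fromℕ 9 * H * H * H)
    (solve 2 (λ h t → κ 72 :* ((κ 9 :* (h :* h)) :* ((κ 3 :* h) :* (:- t) :+ h :* (t :* t)) :+ (:- (h :* h)) :* ((κ 3 :* h) :* (:- t) :+ h :* κ 1))
                   := κ 9 :* (κ 2 :* h) :* (κ 2 :* h) :* (κ 2 :* h) :* (κ 3 :* t) :* (κ 3 :* t)
                      :- κ 72 :* (κ 2 :* h) :* (κ 2 :* h) :* (κ 2 :* h) :* (κ 3 :* t) :- κ 9 :* (κ 2 :* h) :* (κ 2 :* h) :* (κ 2 :* h)) refl half third)
    (solve 0 (κ 9 :* κ 1 :* κ 1 :* κ 1 :* κ 1 :* κ 1 :- κ 72 :* κ 1 :* κ 1 :* κ 1 :* κ 1 :- κ 9 :* κ 1 :* κ 1 :* κ 1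
              := κ 72 :* (:- κ 1)) refl)

  gram₂-distant : gram₂ (third * third) ≡ half
  gram₂-distant = clear-denominators 71
    (λ H T → fromℕ 36 * H * H * H * T * T + fromℕ 9 * H * H * H * T - fromℕ 9 * H * H * H)
    (solve 2 (λ h t → κ 72 :* ((κ 9 :* (h :* h)) :* ((κ 3 :* h) :* (t :* t) :+ h :* (t :* t)) :+ (:- (h :* h)) :* ((κ 3 :* h) :* (:- t) :+ h :* κ 1))
                   := κ 36 :* (κ 2 :* h) :* (κ 2 :* h) :* (κ 2 :* h) :* (κ 3 :* t) :* (κ 3 :* t)
                      :+ κ 9 :* (κ 2 :* h) :* (κ 2 :* h) :* (κ 2 :* h) :* (κ 3 :* t) :- κ 9 :* (κ 2 :* h) :* (κ 2 :* h) :* (κ 2 :* h)) refl half third)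
    (begin
      fromℕ 36 * fromℕ 1 * fromℕ 1 * fromℕ 1 * fromℕ 1 * fromℕ 1 + fromℕ 9 * fromℕ 1 * fromℕ 1 * fromℕ 1 * fromℕ 1
        - fromℕ 9 * fromℕ 1 * fromℕ 1 * fromℕ 1
          ≡⟨ solve 0 (κ 36 :* κ 1 :* κ 1 :* κ 1 :* κ 1 :* κ 1 :+ κ 9 :* κ 1 :* κ 1 :* κ 1 :* κ 1 :- κ 9 :* κ 1 :* κ 1 :* κ 1
                      := κ 36 :* κ 1) refl ⟩
      fromℕ 36 * fromℕ 1            ≡⟨ cong (fromℕ 36 *_) (sym 2*half) ⟩
      fromℕ 36 * (fromℕ 2 * half)   ≡⟨ solve 1 (λ h → κ 36 :* (κ 2 :* h) := κ 72 :* h) refl half ⟩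
      fromℕ 72 * half               ∎)

module Combinatorics where
  open import Data.Nat using (_≤_; s≤s; z≤n)
  open import Data.Nat.DivMod using ([m+n]%n≡m%n)

  remove : ∀ {n} → (Fin n → Bool) → Fin n → Fin n → Bool
  remove f a i = if does (i ≟ a) then false else f i

  remove-other : ∀ {n} (f : Fin n → Bool) {a i} → ¬ i ≡ a → remove f a i ≡ f i
  remove-other f {a} {i} i≢a rewrite dec-false (i ≟ a) i≢a = refl

  count-remove : ∀ {n} (f : Fin n → Bool) a → f a ≡ true → count f ≡ suc (count (remove f a))
  count-remove {suc n} f zero    fa rewrite fa = refl
  count-remove {suc n} f (suc a) fa with f zero
  ... | true  = cong suc (count-remove (λ i → f (suc i)) a fa)
  ... | false = count-remove (λ i → f (suc i)) a fa

  count≡2⇒ : ∀ {n} (f : Fin n → Bool) {x y} → count f ≡ 2 → f x ≡ true → f y ≡ true →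
             ¬ x ≡ y → ∀ z → f z ≡ true → z ≡ x ⊎ z ≡ y
  count≡2⇒ f {x} {y} count≡2 fx fy x≢y z fz with z ≟ x | z ≟ y
  ... | yes z≡x | _       = inj₁ z≡x
  ... | no _    | yes z≡y = inj₂ z≡y
  ... | no z≢x  | no z≢y  = ⊥-elim (three≢2 (begin
    3 ℕ.+ count f₃                ≡⟨ cong (λ k → suc (suc k)) (sym (count-remove f₂ z f₂z)) ⟩
    2 ℕ.+ count f₂                ≡⟨ cong suc (sym (count-remove f₁ y f₁y)) ⟩
    1 ℕ.+ count f₁                ≡⟨ sym (count-remove f x fx) ⟩
    count f                       ≡⟨ count≡2 ⟩
    2                             ∎))
    where
    open ≡-Reasoning
    f₁ = remove f x
    f₂ = remove f₁ y
    f₃ = remove f₂ z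
    f₁y : f₁ y ≡ true
    f₁y = trans (remove-other f (λ y≡x → x≢y (sym y≡x))) fy
    f₂z : f₂ z ≡ true
    f₂z = trans (remove-other f₁ z≢y) (trans (remove-other f z≢x) fz)
    three≢2 : ∀ {k} → ¬ (3 ℕ.+ k ≡ 2)
    three≢2 ()

  data ExactlyOne : Bool → Bool → Bool → Set where
    onlyFirst  : ExactlyOne true  false false
    onlySecond : ExactlyOne false true  false
    onlyThird  : ExactlyOne false false true

  ExactlyOne-shift : ∀ {a b c d} → ExactlyOne a b c → ExactlyOne b c d → d ≡ a
  ExactlyOne-shift onlyFirst  onlyThird  = refl
  ExactlyOne-shift onlySecond onlyFirst  = refl
  ExactlyOne-shift onlyThird  onlySecond = refl

  -- An integer encoding of the window condition used in the equality case: with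
  -- weights -1, 2, -1, the window sum is 2 when the middle entry is true and -1
  -- otherwise exactly when the window contains exactly one true entry.
  weight : Bool → ℤ → ℤ
  weight b z = if b then z else ℤ.+ 0

  windowSum : Bool → Bool → Bool → ℤ
  windowSum a b c = weight a -[1+ 0 ] ℤ.+ (weight b (ℤ.+ 2) ℤ.+ weight c -[1+ 0 ])

  windowSum⇒ExactlyOne : ∀ a b c → windowSum a b c ≡ (if b then ℤ.+ 2 else -[1+ 0 ]) →
                         ExactlyOne a b c
  windowSum⇒ExactlyOne true  false false _ = onlyFirst
  windowSum⇒ExactlyOne false true  false _ = onlySecond
  windowSum⇒ExactlyOne false false true  _ = onlyThird
  windowSum⇒ExactlyOne true  true  true  ()
  windowSum⇒ExactlyOne true  true  false ()
  windowSum⇒ExactlyOne true  false true  ()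
  windowSum⇒ExactlyOne false true  true  ()
  windowSum⇒ExactlyOne false false false ()

  phase : ∀ {a b c} → ExactlyOne a b c → ℕ
  phase onlyFirst  = 0
  phase onlySecond = 1
  phase onlyThird  = 2

  phase<3 : ∀ {a b c} (e : ExactlyOne a b c) → phase e < 3
  phase<3 onlyFirst  = s≤s z≤n
  phase<3 onlySecond = s≤s (s≤s z≤n)
  phase<3 onlyThird  = s≤s (s≤s (s≤s z≤n))

  exactlyOne⇒period3 : (f : ℕ → Bool) (m : ℕ) → 2 ≤ m →
    (∀ k → 2 ℕ.+ k ≤ m → ExactlyOne (f k) (f (1 ℕ.+ k)) (f (2 ℕ.+ k))) →
    Σ ℕ (λ r → r < 3 × (∀ k → k ≤ m → (f k ≡ true) ⇔ (k % 3 ≡ r)))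
  exactlyOne⇒period3 f m 2≤m window = phase first-window , phase<3 first-window , residue
    where
    first-window = window 0 2≤m
    r = phase first-window

    initial : ∀ {a b c} (e : ExactlyOne a b c) →
      ((a ≡ true) ⇔ (0 ≡ phase e)) × ((b ≡ true) ⇔ (1 ≡ phase e)) × ((c ≡ true) ⇔ (2 ≡ phase e))
    initial onlyFirst  = mk⇔ (λ _ → refl) (λ _ → refl) , mk⇔ (λ ()) (λ ()) , mk⇔ (λ ()) (λ ())
    initial onlySecond = mk⇔ (λ ()) (λ ()) , mk⇔ (λ _ → refl) (λ _ → refl) , mk⇔ (λ ()) (λ ())
    initial onlyThird  = mk⇔ (λ ()) (λ ()) , mk⇔ (λ ()) (λ ()) , mk⇔ (λ _ → refl) (λ _ → refl)

    residue : ∀ k → k ≤ m → (f k ≡ true) ⇔ (k % 3 ≡ r)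
    residue 0 _ = proj₁ (initial first-window)
    residue 1 _ = proj₁ (proj₂ (initial first-window))
    residue 2 _ = proj₂ (proj₂ (initial first-window))
    residue (suc (suc (suc k))) k+3≤m = mk⇔
      (λ fk+3 → trans same-residue (Equivalence.to previous (trans (sym same-value) fk+3)))
      (λ k+3≡r → trans same-value (Equivalence.from previous (trans (sym same-residue) k+3≡r)))
      where
      k+2≤m = ℕₚ.≤-trans (ℕₚ.n≤1+n _) k+3≤m
      previous = residue k (ℕₚ.≤-trans (ℕₚ.m≤n+m k 3) k+3≤m)
      same-value : f (3 ℕ.+ k) ≡ f k
      same-value = ExactlyOne-shift (window k k+2≤m) (window (suc k) k+3≤m)
      same-residue : (3 ℕ.+ k) % 3 ≡ k % 3
      same-residue = trans (cong (_% 3) (ℕₚ.+-comm 3 k)) ([m+n]%n≡m%n k 3)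

-- Positions along a cycle c : Fin (suc m) → V, read without wrapping around.
module CyclePositions (m : ℕ) where
  open import Data.Nat using (_≤_)
  open import Data.Nat.DivMod using (_mod_; m≤n⇒m%n≡m)

  position : ℕ → Fin (suc m)
  position k = k mod suc m

  toℕ-position : ∀ {k} → k ≤ m → toℕ (position k) ≡ k
  toℕ-position k≤m = trans (Finₚ.toℕ-fromℕ< _) (m≤n⇒m%n≡m k≤m)

  position-toℕ : ∀ i → position (toℕ i) ≡ i
  position-toℕ i = Finₚ.toℕ-injective (toℕ-position (Finₚ.toℕ≤pred[n] i))

  csuc-position : ∀ {k} → k ≤ m → csuc (position k) ≡ position (suc k)
  csuc-position k≤m = cong (λ n → suc n mod suc m) (toℕ-position k≤m)

  position-injective : ∀ {k l} → k ≤ m → l ≤ m → position k ≡ position l → k ≡ l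
  position-injective k≤m l≤m eq =
    trans (sym (toℕ-position k≤m)) (trans (cong toℕ eq) (toℕ-position l≤m))

module Lemma4 (R : RealField) where
  open RealField R
  open Linear R
  open RealFieldArithmetic R
  open RealFieldOrder R
  open RealFieldFractions R
  open FiniteSums R
  open InnerProducts R
  open HatInnerProducts R
  open Combinatorics
  open ≡-Reasoning

  module Setting
    (A : Fin 76 → Fin 76 → Bool) (srg : IsSRG 76 21 2 7 A)
    (x : Fin 76 → Vec 19)
    (x-unit : ∀ a → ⟪ x a , x a ⟫ ≡ 1ℝ)
    (x-adjacent : ∀ a b → A a b ≡ true → ⟪ x a , x b ⟫ ≡ - (fromℕ 3 ⁻¹))
    (x-nonadjacent : ∀ a b → ¬ (a ≡ b) → A a b ≡ false → ⟪ x a , x b ⟫ ≡ fromℕ 9 ⁻¹)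
    (u : Fin 76) (m : ℕ) (c : Fin (suc m) → Fin 76) (cycle : IsCycleComponentOfG₁ A u m c)
    (w : Fin 76) (w∈G₂ : InG₂ A u w)
    (p : Vec 19) (projection : IsOrthProj (λ i → hat₁ x u (c i)) (hat₂ x u w) p)
    where

    open CyclePositions m

    symmetric : ∀ a b → A a b ≡ A b a
    symmetric = proj₂ (proj₁ srg)

    c-injective : ∀ i j → c i ≡ c j → i ≡ j
    c-injective = proj₁ (proj₂ cycle)

    u~c : ∀ i → A u (c i) ≡ true
    u~c = proj₁ (proj₂ (proj₂ cycle))

    c~u : ∀ i → A (c i) u ≡ true
    c~u i = trans (symmetric (c i) u) (u~c i)

    c≢w : ∀ i → ¬ c i ≡ w
    c≢w i ci≡w with trans (sym (u~c i)) (trans (cong (A u) ci≡w) (proj₁ (proj₂ w∈G₂)))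
    ... | ()

    x-distant : ∀ a b → ¬ a ≡ b → A a b ≡ false → ⟪ x a , x b ⟫ ≡ third * third
    x-distant a b a≢b a≁b = trans (x-nonadjacent a b a≢b a≁b) ninth≡third²

    x-norm : ∀ a → ⟪ x a , x a ⟫ ≡ fromℕ 1
    x-norm a = trans (x-unit a) (sym fromℕ-1)

    g : Fin (suc m) → Vec 19
    g i = hat₁ x u (c i)

    ŵ : Vec 19
    ŵ = hat₂ x u w

    N : Fin (suc m) → Bool
    N i = A w (c i)

    s : ℝ
    s = fromℕ (count N)

    q : Vec 19
    q = (- half) · selectedSum N g

    g-inner : ∀ i j → ⟪ g i , g j ⟫ ≡ gram₁ ⟪ x (c i) , x (c j) ⟫
    g-inner i j = trans (⟪combination⟫ three-halves half three-halves half (x (c i)) (x u) (x (c j)) (x u))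
      (cong₂ (λ a b → three-halves * (three-halves * ⟪ x (c i) , x (c j) ⟫ + half * a) + half * b)
        (x-adjacent (c i) u (c~u i))
        (cong₂ (λ a b → three-halves * a + half * b) (x-adjacent u (c j) (u~c j)) (x-norm u)))

    ŵ-inner : ∀ j → ⟪ ŵ , g j ⟫ ≡ gram₂ ⟪ x w , x (c j) ⟫
    ŵ-inner j = begin
      ⟪ ŵ , g j ⟫
        ≡⟨ ⟪⟫-cong {y = g j} ŵ-as-combination (λ _ → refl) ⟩
      ⟪ (fromℕ 9 * (half * half)) · x w +ᵛ (- (half * half)) · x u , g j ⟫
        ≡⟨ ⟪combination⟫ (fromℕ 9 * (half * half)) (- (half * half)) three-halves half (x w) (x u) (x (c j)) (x u) ⟩
      _ ≡⟨ cong₂ (λ a b → (fromℕ 9 * (half * half)) * (three-halves * ⟪ x w , x (c j) ⟫ + half * a) + (- (half * half)) * b)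
                 (x-distant w u (proj₁ w∈G₂) (trans (symmetric w u) (proj₁ (proj₂ w∈G₂))))
                 (cong₂ (λ a b → three-halves * a + half * b) (x-adjacent u (c j) (u~c j)) (x-norm u)) ⟩
      gram₂ ⟪ x w , x (c j) ⟫ ∎
      where
      ŵ-as-combination : ∀ k → ŵ k ≡ ((fromℕ 9 * (half * half)) · x w +ᵛ (- (half * half)) · x u) k
      ŵ-as-combination k = cong₂ _+_ (cong (λ z → (fromℕ 9 * z) * x w k) quarter≡half²)
        (trans (cong (λ z → - (z * x u k)) quarter≡half²) (-‿distribˡ-* (half * half) (x u k)))

    g-norm : ∀ i → ⟪ g i , g i ⟫ ≡ fromℕ 2
    g-norm i = trans (g-inner i i) (trans (cong gram₁ (x-norm (c i))) gram₁-equal)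

    g-adjacent : ∀ i j → A (c i) (c j) ≡ true → ⟪ g i , g j ⟫ ≡ - fromℕ 1
    g-adjacent i j ci~cj = trans (g-inner i j) (trans (cong gram₁ (x-adjacent _ _ ci~cj)) gram₁-adjacent)

    g-distant : ∀ i j → ¬ i ≡ j → A (c i) (c j) ≡ false → ⟪ g i , g j ⟫ ≡ 0ℝ
    g-distant i j i≢j ci≁cj = trans (g-inner i j)
      (trans (cong gram₁ (x-distant _ _ (λ ci≡cj → i≢j (c-injective i j ci≡cj)) ci≁cj)) gram₁-distant)

    g-off-diagonal : ∀ i j → ¬ i ≡ j → ⟪ g i , g j ⟫ ≤ 0ℝ
    g-off-diagonal i j i≢j with A (c i) (c j) in ci~cj
    ... | true  = subst (_≤ 0ℝ) (sym (g-adjacent i j ci~cj))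
                    (subst (- fromℕ 1 ≤_) -0#≈0# (neg-antitone (0≤fromℕ 1)))
    ... | false = subst (_≤ 0ℝ) (sym (g-distant i j i≢j ci~cj)) (≤-refl 0ℝ)

    p-inner : ∀ j → ⟪ p , g j ⟫ ≡ (if N j then - fromℕ 1 else half)
    p-inner j = trans (orthProj-inner g ŵ p projection j) (trans (ŵ-inner j) (value (N j) refl))
      where
      value : ∀ b → N j ≡ b → gram₂ ⟪ x w , x (c j) ⟫ ≡ (if b then - fromℕ 1 else half)
      value true  w~cj = trans (cong gram₂ (x-adjacent w (c j) w~cj)) gram₂-adjacent
      value false w≁cj = trans (cong gram₂ (x-distant w (c j) (λ w≡cj → c≢w j (sym w≡cj)) w≁cj)) gram₂-distant

    p·q : ⟪ p , q ⟫ ≡ s * half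
    p·q = begin
      ⟪ p , q ⟫                        ≡⟨ ⟪⟫-sym p q ⟩
      ⟪ q , p ⟫                        ≡⟨ ⟪·⟫ (- half) (selectedSum N g) p ⟩
      (- half) * ⟪ selectedSum N g , p ⟫
        ≡⟨ cong ((- half) *_) (trans (⟪selectedSum⟫ N g p) (trans (∑-cong term) (∑-select-const N (- fromℕ 1)))) ⟩
      (- half) * ((- fromℕ 1) * s)     ≡⟨ solve 2 (λ h s → (:- h) :* ((:- κ 1) :* s) := s :* h) refl half s ⟩
      s * half                         ∎
      where
      term : ∀ i → (if N i then ⟪ g i , p ⟫ else 0ℝ) ≡ (if N i then - fromℕ 1 else 0ℝ)
      term i with N i in w~ci
      ... | true  = trans (⟪⟫-sym (g i) p) (trans (p-inner i) (cong (λ b → if b then - fromℕ 1 else half) w~ci))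
      ... | false = refl

    -- ⟪q,q⟫ ≤ s/2, since ⟪∑_{v∈N} v̂, ∑_{v∈N} v̂⟫ ≤ 2s
    q·q≤ : ⟪ q , q ⟫ ≤ s * half
    q·q≤ = subst₂ _≤_ (sym q·q) halve
      (*-monoˡ-≤ ((- half) * (- half)) (square-nonneg (- half))
        (selectedSum-norm≤ g (fromℕ 2) N g-norm g-off-diagonal))
      where
      S = selectedSum N g
      q·q : ⟪ q , q ⟫ ≡ ((- half) * (- half)) * ⟪ S , S ⟫
      q·q = begin
        ⟪ q , q ⟫                          ≡⟨ ⟪·⟫ (- half) S q ⟩
        (- half) * ⟪ S , q ⟫               ≡⟨ cong ((- half) *_) (trans (⟪⟫-sym S q) (⟪·⟫ (- half) S S)) ⟩
        (- half) * ((- half) * ⟪ S , S ⟫)  ≡⟨ sym (*-assoc _ _ _) ⟩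
        ((- half) * (- half)) * ⟪ S , S ⟫  ∎
      halve : ((- half) * (- half)) * (fromℕ 2 * s) ≡ s * half
      halve = begin
        ((- half) * (- half)) * (fromℕ 2 * s) ≡⟨ solve 2 (λ h s → ((:- h) :* (:- h)) :* (κ 2 :* s) := (s :* h) :* (κ 2 :* h)) refl half s ⟩
        (s * half) * (fromℕ 2 * half)         ≡⟨ cong ((s * half) *_) 2*half ⟩
        (s * half) * fromℕ 1                  ≡⟨ solve 1 (λ z → z :* κ 1 := z) refl (s * half) ⟩
        s * half                              ∎

    comparison : s * half ≤ ⟪ p , p ⟫ × (⟪ p , p ⟫ ≡ s * half → ∀ k → p k ≡ q k)
    comparison = norm-comparison p q (s * half) p·q q·q≤

    lower-bound : s * half ≤ ⟪ p , p ⟫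
    lower-bound = proj₁ comparison

    module Window (k : ℕ) (k+2≤m : 2 ℕ.+ k ℕ.≤ m) where
      k≤m : k ℕ.≤ m
      k≤m = ℕₚ.≤-trans (ℕₚ.m≤n+m k 2) k+2≤m

      k+1≤m : 1 ℕ.+ k ℕ.≤ m
      k+1≤m = ℕₚ.≤-trans (ℕₚ.n≤1+n _) k+2≤m

      a j e : Fin (suc m)
      a = position k
      j = position (1 ℕ.+ k)
      e = position (2 ℕ.+ k)

      a≢j : ¬ a ≡ j
      a≢j a≡j = ℕₚ.m≢1+m+n k {0} (trans (position-injective k≤m k+1≤m a≡j) (cong suc (sym (ℕₚ.+-identityʳ k))))

      a≢e : ¬ a ≡ e
      a≢e a≡e = ℕₚ.m≢1+m+n k {1} (trans (position-injective k≤m k+2≤m a≡e) (cong suc (ℕₚ.+-comm 1 k)))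

      j≢e : ¬ j ≡ e
      j≢e j≡e = ℕₚ.m≢1+m+n (suc k) {0}
        (trans (position-injective k+1≤m k+2≤m j≡e) (cong (λ n → suc (suc n)) (sym (ℕₚ.+-identityʳ k))))

      a~j : A (c a) (c j) ≡ true
      a~j = trans (cong (λ i → A (c a) (c i)) (sym (csuc-position k≤m))) (proj₁ (proj₂ (proj₂ (proj₂ cycle))) a)

      e~j : A (c e) (c j) ≡ true
      e~j = trans (symmetric (c e) (c j))
        (trans (cong (λ i → A (c j) (c i)) (sym (csuc-position k+1≤m))) (proj₁ (proj₂ (proj₂ (proj₂ cycle))) j))

      u≢cj : ¬ u ≡ c j
      u≢cj u≡cj with trans (sym (proj₁ (proj₁ srg) u)) (trans (cong (A u) u≡cj) (u~c j))
      ... | ()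

      -- Since λ = 2, u and c_j have only the two common neighbours c_a and c_e,
      -- so these are the only neighbours of c_j on the cycle.
      cycle-neighbours : ∀ i → A (c i) (c j) ≡ true → i ≡ a ⊎ i ≡ e
      cycle-neighbours i ci~cj with count≡2⇒ (λ z → A u z ∧ A (c j) z)
             (proj₁ (proj₂ (proj₂ srg)) u (c j) u≢cj (u~c j))
             (cong₂ _∧_ (u~c a) (trans (symmetric (c j) (c a)) a~j))
             (cong₂ _∧_ (u~c e) (trans (symmetric (c j) (c e)) e~j))
             (λ ca≡ce → a≢e (c-injective a e ca≡ce))
             (c i) (cong₂ _∧_ (u~c i) (trans (symmetric (c j) (c i)) ci~cj))
      ... | inj₁ ci≡ca = inj₁ (c-injective i a ci≡ca)
      ... | inj₂ ci≡ce = inj₂ (c-injective i e ci≡ce)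

      S·g : ⟪ selectedSum N g , g j ⟫ ≡ ⟦ windowSum (N a) (N j) (N e) ⟧ℤ
      S·g = begin
        ⟪ selectedSum N g , g j ⟫        ≡⟨ ⟪selectedSum⟫ N g (g j) ⟩
        ∑ F                              ≡⟨ ∑-support₃ F a j e a≢j a≢e j≢e outside ⟩
        F a + (F j + F e)                ≡⟨ cong₂ _+_ (weighted a (g-adjacent a j a~j))
                                              (cong₂ _+_ (weighted j (g-norm j)) (weighted e (g-adjacent e j e~j))) ⟩
        ⟦ weight (N a) -[1+ 0 ] ⟧ℤ + (⟦ weight (N j) (ℤ.+ 2) ⟧ℤ + ⟦ weight (N e) -[1+ 0 ] ⟧ℤ)
          ≡⟨ sym (trans (+-hom (weight (N a) -[1+ 0 ]) _) (cong (⟦ weight (N a) -[1+ 0 ] ⟧ℤ +_) (+-hom (weight (N j) (ℤ.+ 2)) _))) ⟩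
        ⟦ windowSum (N a) (N j) (N e) ⟧ℤ ∎
        where
        F : Fin (suc m) → ℝ
        F i = if N i then ⟪ g i , g j ⟫ else 0ℝ
        weighted : ∀ i {z} → ⟪ g i , g j ⟫ ≡ ⟦ z ⟧ℤ → F i ≡ ⟦ weight (N i) z ⟧ℤ
        weighted i eq with N i
        ... | true  = eq
        ... | false = refl
        outside : ∀ i → ¬ i ≡ a → ¬ i ≡ j → ¬ i ≡ e → F i ≡ 0ℝ
        outside i i≢a i≢j i≢e with N i | A (c i) (c j) in ci~cj
        ... | false | _     = refl
        ... | true  | false = g-distant i j i≢j ci~cj
        ... | true  | true  with cycle-neighbours i ci~cj
        ... | inj₁ i≡a = ⊥-elim (i≢a i≡a)
        ... | inj₂ i≡e = ⊥-elim (i≢e i≡e)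

      -- If p = q then ⟪q,ĵ⟫ = ⟪p,ĵ⟫, which forces exactly one of a, j, e into N.
      exactly-one : (∀ k → p k ≡ q k) → ExactlyOne (N a) (N j) (N e)
      exactly-one p≡q = windowSum⇒ExactlyOne (N a) (N j) (N e) (⟦⟧ℤ-injective _ _ (begin
        ⟦ ws ⟧ℤ                             ≡⟨ solve 1 (λ z → z := κ 1 :* z) refl ⟦ ws ⟧ℤ ⟩
        fromℕ 1 * ⟦ ws ⟧ℤ                   ≡⟨ cong (_* ⟦ ws ⟧ℤ) (sym 2*half) ⟩
        (fromℕ 2 * half) * ⟦ ws ⟧ℤ          ≡⟨ solve 2 (λ h z → (κ 2 :* h) :* z := (:- κ 2) :* ((:- h) :* z)) refl half ⟦ ws ⟧ℤ ⟩
        (- fromℕ 2) * ((- half) * ⟦ ws ⟧ℤ)  ≡⟨ cong ((- fromℕ 2) *_) q·g ⟩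
        (- fromℕ 2) * ⟪ p , g j ⟫           ≡⟨ cong ((- fromℕ 2) *_) (p-inner j) ⟩
        (- fromℕ 2) * (if N j then - fromℕ 1 else half) ≡⟨ doubled (N j) ⟩
        ⟦ if N j then ℤ.+ 2 else -[1+ 0 ] ⟧ℤ ∎))
        where
        ws = windowSum (N a) (N j) (N e)
        q·g : (- half) * ⟦ ws ⟧ℤ ≡ ⟪ p , g j ⟫
        q·g = begin
          (- half) * ⟦ ws ⟧ℤ                  ≡⟨ cong ((- half) *_) (sym S·g) ⟩
          (- half) * ⟪ selectedSum N g , g j ⟫ ≡⟨ sym (⟪·⟫ (- half) (selectedSum N g) (g j)) ⟩
          ⟪ q , g j ⟫                         ≡⟨ ⟪⟫-cong {y = g j} (λ k → sym (p≡q k)) (λ _ → refl) ⟩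
          ⟪ p , g j ⟫                         ∎
        doubled : ∀ b → (- fromℕ 2) * (if b then - fromℕ 1 else half) ≡ ⟦ if b then ℤ.+ 2 else -[1+ 0 ] ⟧ℤ
        doubled true  = solve 0 ((:- κ 2) :* (:- κ 1) := κ 2) refl
        doubled false = trans (solve 1 (λ h → (:- κ 2) :* h := :- (κ 2 :* h)) refl half)
                              (cong (λ z → - z) 2*half)

    equality⇒pattern : ⟪ p , p ⟫ ≡ s * half →
      Σ ℕ (λ r → r < 3 × (∀ i → (N i ≡ true) ⇔ (toℕ i % 3 ≡ r))) × (∀ k → p k ≡ q k)
    equality⇒pattern p·p≡ = (r , r<3 , residue) , p≡q
      where
      p≡q = proj₂ comparison p·p≡
      period = exactlyOne⇒period3 (λ k → N (position k)) m (proj₁ cycle)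
                 (λ k k+2≤m → Window.exactly-one k k+2≤m p≡q)
      r = proj₁ period
      r<3 = proj₁ (proj₂ period)
      residue : ∀ i → (N i ≡ true) ⇔ (toℕ i % 3 ≡ r)
      residue i = subst (λ i′ → (N i′ ≡ true) ⇔ (toℕ i % 3 ≡ r)) (position-toℕ i)
                    (proj₂ (proj₂ period) (toℕ i) (Finₚ.toℕ≤pred[n] i))

    pattern⇒equality : Σ ℕ (λ r → r < 3 × (∀ i → (N i ≡ true) ⇔ (toℕ i % 3 ≡ r))) × (∀ k → p k ≡ q k) →
                       ⟪ p , p ⟫ ≡ s * half
    pattern⇒equality (_ , p≡q) = trans (⟪⟫-cong {x = p} (λ _ → refl) p≡q) p·q

lemma4 : (R : RealField) → let open RealField R in let open Linear R in
  (A : Fin 76 → Fin 76 → Bool) → IsSRG 76 21 2 7 A →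
  (x : Fin 76 → Vec 19) →
  (∀ a → ⟪ x a , x a ⟫ ≡ 1ℝ) →
  (∀ a b → A a b ≡ true → ⟪ x a , x b ⟫ ≡ - (fromℕ 3 ⁻¹)) →
  (∀ a b → ¬ (a ≡ b) → A a b ≡ false → ⟪ x a , x b ⟫ ≡ fromℕ 9 ⁻¹) →
  (u : Fin 76) →
  (m : ℕ) (c : Fin (suc m) → Fin 76) → IsCycleComponentOfG₁ A u m c →
  (w : Fin 76) → InG₂ A u w →
  (p : Vec 19) → IsOrthProj (λ i → hat₁ x u (c i)) (hat₂ x u w) p →
  (fromℕ (count (λ i → A w (c i))) * fromℕ 2 ⁻¹ ≤ ⟪ p , p ⟫) ×
  ((⟪ p , p ⟫ ≡ fromℕ (count (λ i → A w (c i))) * fromℕ 2 ⁻¹) ⇔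
    ((Σ ℕ (λ r → r < 3 × (∀ i → (A w (c i) ≡ true) ⇔ (toℕ i % 3 ≡ r)))) ×
     (∀ k → p k ≡ (- (fromℕ 2 ⁻¹)) *
        ∑ᵛ (λ i → if A w (c i) then hat₁ x u (c i) else (λ _ → 0ℝ)) k)))
lemma4 R A srg x x-unit x-adjacent x-nonadjacent u m c cycle w w∈G₂ p projection =
  lower-bound , mk⇔ equality⇒pattern pattern⇒equality
  where open Lemma4.Setting R A srg x x-unit x-adjacent x-nonadjacent u m c cycle w w∈G₂ p projection
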